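{- Let $\mathbf{R}=\langle R,+,\cdot,\alpha,0,1\rangle$ be a Łukasiewicz semiring and let $x\oplus y=\alpha\big((\alpha(x)+y)\cdot\alpha(y)\big)$ for $x,y\in R$. Then $\mathbf{M}(\mathbf{R})=\langle R,\oplus,\alpha,0\rangle$ (with $\alpha$ playing the role of $'$) is an MV-algebra.
   Context: An MV-algebra is an algebra $\langle M,\oplus,{}',0\rangle$ of type $\langle 2,1,0\rangle$ such that $\langle M,\oplus,0\rangle$ is a commutative monoid, $x''=x$, $x\oplus 0'=0'$, and $(x'\oplus y)'\oplus y=(y'\oplus x)'\oplus x$. A semiring is an algebra $\langle R,+,\cdot,0,1\rangle$ such that $\langle R,+,0\rangle$ is a commutative monoid, $\langle R,\cdot,1\rangle$ is a monoid, both distributive laws $(x+y)\cdot z=(x\cdot z)+(y\cdot z)$ and $x\cdot(y+z)=(x\cdot y)+(x\cdot z)$ hold, and $x\cdot 0=0\cdot x=0$. If $x+x=x$ holds (idempotency), then $x\le y$ iff $x+y=y$ defines a partial order. A Łukasiewicz semiring is an idempotent semiring (multiplication is not assumed commutative) together with a map $\alpha:R\to R$ such that $\alpha(\alpha(x))=x$; $x\le y$ implies $\alpha(y)\le\alpha(x)$; and $\alpha(x\cdot\alpha(y))\cdot\alpha(y)=\alpha(y\cdot\alpha(x))\cdot\alpha(x)$ for all $x,y$. -}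

module Defs where

open import Level using (Level; suc; _⊔_)
open import Relation.Binary.Core using (Rel)
open import Algebra.Core using (Op₁; Op₂)
import Algebra.Definitions as AlgebraDefinitions
import Algebra.Structures as AlgebraStructures

module _ {a ℓ : Level} {A : Set a} (_≈_ : Rel A ℓ) where

  open AlgebraDefinitions _≈_
  open AlgebraStructures _≈_

  -- The two fields ending in -cong hold automatically when _≈_ is
  -- propositional equality.

  record IsMVAlgebra (_⊕_ : Op₂ A) (_′ : Op₁ A) (0# : A) : Set (a ⊔ ℓ) where
    field
      ⊕-isCommutativeMonoid : IsCommutativeMonoid _⊕_ 0#
      ′-cong                : Congruent₁ _′
      ′-involutive          : Involutive _′
      ⊕-zeroʳ               : RightZero (0# ′) _⊕_
      łukasiewicz           : ∀ x y →
        ((((x ′) ⊕ y) ′) ⊕ y) ≈ ((((y ′) ⊕ x) ′) ⊕ x)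

  record IsŁukasiewiczSemiring (_+_ _·_ : Op₂ A) (α : Op₁ A) (0# 1# : A)
         : Set (a ⊔ ℓ) where

    _≤_ : Rel A ℓ
    x ≤ y = (x + y) ≈ y

    field
      isIdempotentSemiring : IsIdempotentSemiring _+_ _·_ 0# 1#
      α-cong               : Congruent₁ α
      α-involutive         : Involutive α
      α-antitone           : ∀ {x y} → x ≤ y → α y ≤ α x
      łukasiewicz          : ∀ x y →
        (α (x · α y) · α y) ≈ (α (y · α x) · α x)

    open IsIdempotentSemiring isIdempotentSemiring public

record ŁukasiewiczSemiring (c ℓ : Level) : Set (suc (c ⊔ ℓ)) where
  infixl 7 _·_
  infixl 6 _+_ _⊕_
  infix  4 _≈_
  field
    Carrier               : Set c
    _≈_                   : Rel Carrier ℓ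
    _+_                   : Op₂ Carrier
    _·_                   : Op₂ Carrier
    α                     : Op₁ Carrier
    0#                    : Carrier
    1#                    : Carrier
    isŁukasiewiczSemiring : IsŁukasiewiczSemiring _≈_ _+_ _·_ α 0# 1#

  open IsŁukasiewiczSemiring isŁukasiewiczSemiring public

  _⊕_ : Op₂ Carrier
  x ⊕ y = α ((α x + y) · α y)

{-# OPTIONS --safe #-}
-- Applying the Łukasiewicz identity at 0 and 1 shows first that α 1 = 0, so
-- that 1 is the greatest element, and then that x · α x = 0.  Hence
-- x ⊕ y = α (α x · α y), and everything reduces to commutativity of the
-- product: the identity gives α (x · y) · y ≤ α x, so α (x · y) · (y · x) = 0,
-- and a vanishing product a · b forces b ≤ α a, whence y · x ≤ x · y.
module Submission where

open import Data.Product.Base using (_,_)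
open import Defs
import Relation.Binary.Reasoning.Setoid as SetoidReasoning

module ŁukasiewiczSemiringProperties {c ℓ} (R : ŁukasiewiczSemiring c ℓ) where

  open ŁukasiewiczSemiring R renaming (_≤_ to infix 4 _≤_)
  open SetoidReasoning setoid

  ≤-antisym : ∀ {x y} → x ≤ y → y ≤ x → x ≈ y
  ≤-antisym {x} {y} x≤y y≤x = begin
    x      ≈⟨ y≤x ⟨
    y + x  ≈⟨ +-comm y x ⟩
    x + y  ≈⟨ x≤y ⟩
    y      ∎

  ≤-trans : ∀ {x y z} → x ≤ y → y ≤ z → x ≤ z
  ≤-trans {x} {y} {z} x≤y y≤z = begin
    x + z        ≈⟨ +-congˡ y≤z ⟨
    x + (y + z)  ≈⟨ +-assoc x y z ⟨
    x + y + z    ≈⟨ +-congʳ x≤y ⟩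
    y + z        ≈⟨ y≤z ⟩
    z            ∎

  ≤-respˡ : ∀ {x y z} → x ≈ y → x ≤ z → y ≤ z
  ≤-respˡ x≈y x≤z = trans (+-congʳ (sym x≈y)) x≤z

  ≤-respʳ : ∀ {x y z} → y ≈ z → x ≤ y → x ≤ z
  ≤-respʳ y≈z x≤y = trans (+-congˡ (sym y≈z)) (trans x≤y y≈z)

  ·-monoˡ : ∀ {x y} z → x ≤ y → x · z ≤ y · z
  ·-monoˡ {x} {y} z x≤y = trans (sym (distribʳ z x y)) (*-congʳ x≤y)

  ·-monoʳ : ∀ {x y} z → x ≤ y → z · x ≤ z · y
  ·-monoʳ {x} {y} z x≤y = trans (sym (distribˡ z x y)) (*-congˡ x≤y)

  0-minimum : ∀ x → 0# ≤ x
  0-minimum = +-identityˡ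

  x≤0⇒x≈0 : ∀ {x} → x ≤ 0# → x ≈ 0#
  x≤0⇒x≈0 {x} x≤0 = ≤-antisym x≤0 (0-minimum x)

  -- Antitonicity turns the least element into a greatest one. That this top is `1#` itself is known
  -- only after `α1≈0`.
  α0-maximum : ∀ x → x ≤ α 0#
  α0-maximum x = ≤-respˡ (α-involutive x) (α-antitone (0-minimum (α x)))

  -- The Łukasiewicz identity at `x` and `α y` with the double `α` cancelled. In this form a bare
  -- product `x · y` appears on the left, and the right side is a left multiple of `α x`.
  α-swap : ∀ x y → α (x · y) · y ≈ α (α y · α x) · α x
  α-swap x y = begin
    α (x · y) · y                  ≈⟨ *-cong (α-cong (*-congˡ (α-involutive y))) (α-involutive y) ⟨
    α (x · α (α y)) · α (α y)      ≈⟨ łukasiewicz x (α y) ⟩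
    α (α y · α x) · α x            ∎

  -- Since `1#` lies below `T`, there is a chain `e ≤ e · T ≤ T · (e · T)`, and two uses of `α-swap`
  -- make its upper end vanish.
  α1≈0 : α 1# ≈ 0#
  α1≈0 = x≤0⇒x≈0 (≤-respʳ TeT≈0
    (≤-trans (≤-respˡ (*-identityʳ e) (·-monoʳ e (α0-maximum 1#)))
             (≤-respˡ (*-identityˡ (e · T)) (·-monoˡ (e · T) (α0-maximum 1#)))))
    where
    T = α 0#
    e = α 1#
    u = α (e · T)

    uT≈T : u · T ≈ T
    uT≈T = begin
      u · T             ≈⟨ α-swap 0# 1# ⟨
      α (0# · 1#) · 1#  ≈⟨ *-identityʳ _ ⟩
      α (0# · 1#)       ≈⟨ α-cong (zeroˡ 1#) ⟩
      T                 ∎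

    TeT≈0 : T · (e · T) ≈ 0#
    TeT≈0 = begin
      T · (e · T)          ≈⟨ *-congˡ (α-involutive (e · T)) ⟨
      -- The leading `T` is inflated to `α (α T · α u)`, which is allowed because `α T` is zero.
      -- This produces the right side of `α-swap u T`.
      T · α u              ≈⟨ *-congʳ (α-cong (trans (*-congʳ (α-involutive 0#)) (zeroˡ (α u)))) ⟨
      α (α T · α u) · α u  ≈⟨ α-swap u T ⟨
      α (u · T) · T        ≈⟨ *-congʳ (α-cong uT≈T) ⟩
      α T · T              ≈⟨ *-congʳ (α-involutive 0#) ⟩
      0# · T               ≈⟨ zeroˡ T ⟩
      0#                   ∎

  α0≈1 : α 0# ≈ 1#
  α0≈1 = trans (α-cong (sym α1≈0)) (α-involutive 1#)

  1-maximum : ∀ x → x ≤ 1#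
  1-maximum x = ≤-respʳ α0≈1 (α0-maximum x)

  -- With `1#` on top, an extra left factor can only shrink a product.
  x·y≤y : ∀ x y → x · y ≤ y
  x·y≤y x y = ≤-respʳ (*-identityˡ y) (·-monoˡ y (1-maximum x))

  -- This is `α-swap` at `x` and `0#`: one side ends in the factor `0#`, the other simplifies
  -- because `α 0#` is the unit.
  x·αx≈0 : ∀ x → x · α x ≈ 0#
  x·αx≈0 x = begin
    x · α x               ≈⟨ *-congʳ (α-involutive x) ⟨
    α (α x) · α x         ≈⟨ *-congʳ (α-cong (trans (*-congʳ α0≈1) (*-identityˡ (α x)))) ⟨
    α (α 0# · α x) · α x  ≈⟨ α-swap x 0# ⟨
    α (x · 0#) · 0#       ≈⟨ zeroʳ _ ⟩
    0#                    ∎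

  αx·x≈0 : ∀ x → α x · x ≈ 0#
  αx·x≈0 x = trans (*-congˡ (sym (α-involutive x))) (x·αx≈0 (α x))

  -- When the product vanishes, the left side of `α-swap x y` collapses to `y`, while the right side
  -- is a left multiple of `α x`.
  x·y≈0⇒y≤αx : ∀ {x y} → x · y ≈ 0# → y ≤ α x
  x·y≈0⇒y≤αx {x} {y} xy≈0 = ≤-respˡ eq (x·y≤y (α (α y · α x)) (α x))
    where
    eq : α (α y · α x) · α x ≈ y
    eq = begin
      α (α y · α x) · α x  ≈⟨ α-swap x y ⟨
      α (x · y) · y        ≈⟨ *-congʳ (trans (α-cong xy≈0) α0≈1) ⟩
      1# · y               ≈⟨ *-identityˡ y ⟩
      y                    ∎

  y·x≤x·y : ∀ x y → y · x ≤ x · y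
  y·x≤x·y x y = ≤-respʳ (α-involutive (x · y)) (x·y≈0⇒y≤αx α[xy]·yx≈0)
    where
    α[xy]·y≤αx : α (x · y) · y ≤ α x
    α[xy]·y≤αx = ≤-respˡ (sym (α-swap x y)) (x·y≤y (α (α y · α x)) (α x))

    α[xy]·yx≈0 : α (x · y) · (y · x) ≈ 0#
    α[xy]·yx≈0 = trans (sym (*-assoc (α (x · y)) y x))
      (x≤0⇒x≈0 (≤-respʳ (αx·x≈0 x) (·-monoˡ x α[xy]·y≤αx)))

  ·-comm : ∀ x y → x · y ≈ y · x
  ·-comm x y = ≤-antisym (y·x≤x·y y x) (y·x≤x·y x y)

  -- Distributing leaves the cross term `y · α y`, which is zero. The result is a De Morgan law that
  -- carries the monoid laws of the product over to `⊕`.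
  ⊕-dual : ∀ x y → x ⊕ y ≈ α (α x · α y)
  ⊕-dual x y = α-cong (begin
    (α x + y) · α y        ≈⟨ distribʳ (α y) (α x) y ⟩
    α x · α y + y · α y    ≈⟨ +-congˡ (x·αx≈0 y) ⟩
    α x · α y + 0#         ≈⟨ +-identityʳ _ ⟩
    α x · α y              ∎)

  α-⊕ : ∀ x y → α (x ⊕ y) ≈ α x · α y
  α-⊕ x y = trans (α-cong (⊕-dual x y)) (α-involutive _)

  ⊕-cong : ∀ {x y u v} → x ≈ y → u ≈ v → x ⊕ u ≈ y ⊕ v
  ⊕-cong x≈y u≈v = α-cong (*-cong (+-cong (α-cong x≈y) u≈v) (α-cong u≈v))

  ⊕-assoc : ∀ x y z → (x ⊕ y) ⊕ z ≈ x ⊕ (y ⊕ z)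
  ⊕-assoc x y z = begin
    (x ⊕ y) ⊕ z              ≈⟨ ⊕-dual (x ⊕ y) z ⟩
    α (α (x ⊕ y) · α z)      ≈⟨ α-cong (*-congʳ (α-⊕ x y)) ⟩
    α (α x · α y · α z)      ≈⟨ α-cong (*-assoc (α x) (α y) (α z)) ⟩
    α (α x · (α y · α z))    ≈⟨ α-cong (*-congˡ (α-⊕ y z)) ⟨
    α (α x · α (y ⊕ z))      ≈⟨ ⊕-dual x (y ⊕ z) ⟨
    x ⊕ (y ⊕ z)              ∎

  ⊕-comm : ∀ x y → x ⊕ y ≈ y ⊕ x
  ⊕-comm x y = begin
    x ⊕ y          ≈⟨ ⊕-dual x y ⟩
    α (α x · α y)  ≈⟨ α-cong (·-comm (α x) (α y)) ⟩
    α (α y · α x)  ≈⟨ ⊕-dual y x ⟨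
    y ⊕ x          ∎

  ⊕-identityˡ : ∀ x → 0# ⊕ x ≈ x
  ⊕-identityˡ x = begin
    0# ⊕ x          ≈⟨ ⊕-dual 0# x ⟩
    α (α 0# · α x)  ≈⟨ α-cong (*-congʳ α0≈1) ⟩
    α (1# · α x)    ≈⟨ α-cong (*-identityˡ (α x)) ⟩
    α (α x)         ≈⟨ α-involutive x ⟩
    x               ∎

  ⊕-zeroʳ : ∀ x → x ⊕ α 0# ≈ α 0#
  ⊕-zeroʳ x = begin
    x ⊕ α 0#            ≈⟨ ⊕-dual x (α 0#) ⟩
    α (α x · α (α 0#))  ≈⟨ α-cong (*-congˡ (α-involutive 0#)) ⟩
    α (α x · 0#)        ≈⟨ α-cong (zeroʳ (α x)) ⟩
    α 0#                ∎

  -- Each side of the MV axiom becomes `α` of a side of the semiring's own Łukasiewicz identity.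
  α[αx⊕y]⊕y : ∀ x y → α (α x ⊕ y) ⊕ y ≈ α (α (x · α y) · α y)
  α[αx⊕y]⊕y x y = begin
    α (α x ⊕ y) ⊕ y          ≈⟨ ⊕-cong (α-⊕ (α x) y) refl ⟩
    (α (α x) · α y) ⊕ y      ≈⟨ ⊕-cong (*-congʳ (α-involutive x)) refl ⟩
    (x · α y) ⊕ y            ≈⟨ ⊕-dual (x · α y) y ⟩
    α (α (x · α y) · α y)    ∎

  ⊕-łukasiewicz : ∀ x y → α (α x ⊕ y) ⊕ y ≈ α (α y ⊕ x) ⊕ x
  ⊕-łukasiewicz x y = begin
    α (α x ⊕ y) ⊕ y          ≈⟨ α[αx⊕y]⊕y x y ⟩
    α (α (x · α y) · α y)    ≈⟨ α-cong (łukasiewicz x y) ⟩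
    α (α (y · α x) · α x)    ≈⟨ α[αx⊕y]⊕y y x ⟨
    α (α y ⊕ x) ⊕ x          ∎

corollary4 : ∀ {c ℓ} (R : ŁukasiewiczSemiring c ℓ) →
    let open ŁukasiewiczSemiring R in
    IsMVAlgebra _≈_ _⊕_ α 0#
corollary4 R = record
  { ⊕-isCommutativeMonoid = record
    { isMonoid = record
      { isSemigroup = record
        { isMagma = record { isEquivalence = isEquivalence ; ∙-cong = ⊕-cong }
        ; assoc = ⊕-assoc
        }
      ; identity = ⊕-identityˡ , λ x → trans (⊕-comm x 0#) (⊕-identityˡ x)
      }
    ; comm = ⊕-comm
    }
  ; ′-cong       = α-cong
  ; ′-involutive = α-involutive
  ; ⊕-zeroʳ      = ⊕-zeroʳ
  ; łukasiewicz  = ⊕-łukasiewicz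
  }
  where
  open ŁukasiewiczSemiring R
  open ŁukasiewiczSemiringProperties R
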